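{- Let $G$ be a graph and $k\ge1$. Then $M_k(G)$ is a trivial matroid if and only if $G$ has no subgraph $F$ such that $F$ is a cacti-graph and $\Delta F=k$.
   Context: Graphs are finite, may have loops and parallel edges, and have no isolated vertices. A leaf is a vertex incident to exactly one edge, which is not a loop. $\Delta H=|E(H)|-|V(H)|$. A cacti-graph is a graph with no isolated vertices, no leaves, and no component that is a cycle. For $X\subseteq E(G)$, $G\langle X\rangle$ is the subgraph with edge set $X$ and vertex set the vertices incident to $X$. For $k\ge0$, $M_k(G)$ is the matroid on $E(G)$ whose circuits are the inclusion-minimal members of $\{C\subseteq E(G):C\neq\emptyset,\ |C|=|V(G\langle C\rangle)|+k\}$. A matroid on $E$ is trivial if $E$ is a base or a cobase (equivalently it has no circuit or no cocircuit), and non-trivial otherwise. -}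

module Defs where

open import Data.Bool.Base using (true)
open import Data.Fin.Base using (Fin; toℕ)
open import Data.Fin.Properties using (any?) renaming (_≟_ to _≟ᶠ_)
open import Data.Fin.Subset
open import Data.Fin.Subset.Induction using (⊂-wellFounded; Acc; acc)
open import Data.Fin.Subset.Properties
open import Data.Integer.Base using (ℤ; _⊖_)
open import Data.Nat.Base using (ℕ; suc; _+_; _≤_; _<_; s≤s; s≤s⁻¹)
open import Data.Nat.DivMod using (_mod_)
open import Data.Nat.Properties
  using (_≟_; _≤?_; ≰⇒>; ≤∧≢⇒<; ≤-reflexive; ≤-trans; m≤m+n; +-suc; +-comm;
         +-mono-≤; +-monoʳ-<; +-monoˡ-≤; +-cancelʳ-<; module ≤-Reasoning)
open import Data.Nat.Tactic.RingSolver using (solve-∀)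
open import Data.Product.Base using (∃; _×_; _,_; proj₁; proj₂)
open import Data.Sum.Base using (_⊎_; inj₁; inj₂)
import Data.Sum.Base as Sum
open import Data.Vec.Base using (tabulate; []; _∷_)
open import Data.Vec.Properties using ([]=⇒lookup; lookup⇒[]=; lookup∘tabulate)
open import Function.Base using (_∘_)
open import Function.Bundles using (_⇔_)
open import Function.Definitions using (Injective)
open import Level using (Level; 0ℓ)
open import Relation.Binary.Construct.Closure.ReflexiveTransitive using (Star)
open import Relation.Binary.PropositionalEquality
  using (_≡_; _≢_; refl; sym; trans; cong; cong₂; subst)
open import Relation.Nullary
  using (¬_; Dec; does; yes; no; _×-dec_; _⊎-dec_; contradiction)
open import Relation.Nullary.Decidable using (dec-true)
open import Relation.Unary using (Pred; Decidable)

private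
  variable
    ℓ : Level
    n : ℕ

------------------------------------------------------------------------
-- Finite sets

compr : {P : Pred (Fin n) ℓ} → Decidable P → Subset n
compr P? = tabulate (does ∘ P?)

module _ {P : Pred (Fin n) ℓ} (P? : Decidable P) where

  ∈-compr⁺ : ∀ {x} → P x → x ∈ compr P?
  ∈-compr⁺ {x} px =
    lookup⇒[]= x _ (trans (lookup∘tabulate (does ∘ P?) x) (dec-true (P? x) px))

  ∈-compr⁻ : ∀ {x} → x ∈ compr P? → P x
  ∈-compr⁻ {x} x∈ = fromDoes (P? x)
    (trans (sym (lookup∘tabulate (does ∘ P?) x)) ([]=⇒lookup x∈))
    where
    fromDoes : ∀ {a} {A : Set a} (d : Dec A) → does d ≡ true → A
    fromDoes (yes a) _ = a

∣p∪q∣+∣p∩q∣≡∣p∣+∣q∣ : (p q : Subset n) → ∣ p ∪ q ∣ + ∣ p ∩ q ∣ ≡ ∣ p ∣ + ∣ q ∣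
∣p∪q∣+∣p∩q∣≡∣p∣+∣q∣ [] [] = refl
∣p∪q∣+∣p∩q∣≡∣p∣+∣q∣ (outside ∷ p) (outside ∷ q) = ∣p∪q∣+∣p∩q∣≡∣p∣+∣q∣ p q
∣p∪q∣+∣p∩q∣≡∣p∣+∣q∣ (outside ∷ p) (inside  ∷ q) =
  trans (cong suc (∣p∪q∣+∣p∩q∣≡∣p∣+∣q∣ p q)) (sym (+-suc _ _))
∣p∪q∣+∣p∩q∣≡∣p∣+∣q∣ (inside  ∷ p) (outside ∷ q) =
  cong suc (∣p∪q∣+∣p∩q∣≡∣p∣+∣q∣ p q)
∣p∪q∣+∣p∩q∣≡∣p∣+∣q∣ (inside  ∷ p) (inside  ∷ q) = cong suc
  (trans (+-suc _ _) (trans (cong suc (∣p∪q∣+∣p∩q∣≡∣p∣+∣q∣ p q)) (sym (+-suc _ _))))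

∣p∣≤1+∣p-x∣ : (p : Subset n) (x : Fin n) → ∣ p ∣ ≤ suc ∣ p - x ∣
∣p∣≤1+∣p-x∣ p x = begin
  ∣ p ∣                                              ≤⟨ p⊆q⇒∣p∣≤∣q∣ p⊆ ⟩
  ∣ (p - x) ∪ ⁅ x ⁆ ∣                                ≤⟨ m≤m+n _ _ ⟩
  ∣ (p - x) ∪ ⁅ x ⁆ ∣ + ∣ (p - x) ∩ ⁅ x ⁆ ∣          ≡⟨ ∣p∪q∣+∣p∩q∣≡∣p∣+∣q∣ (p - x) ⁅ x ⁆ ⟩
  ∣ p - x ∣ + ∣ ⁅ x ⁆ ∣                              ≡⟨ cong (∣ p - x ∣ +_) (∣⁅x⁆∣≡1 x) ⟩
  ∣ p - x ∣ + 1                                      ≡⟨ +-comm _ 1 ⟩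
  suc ∣ p - x ∣                                      ∎
  where
  open ≤-Reasoning
  p⊆ : p ⊆ (p - x) ∪ ⁅ x ⁆
  p⊆ {y} y∈p with y ≟ᶠ x
  ... | yes refl = x∈p∪q⁺ (inj₂ (x∈⁅x⁆ x))
  ... | no  y≢x  = x∈p∪q⁺ (inj₁ (x∈p∧x≢y⇒x∈p-y y∈p y≢x))

1≤∣p∣⇒Nonempty : (p : Subset n) → 1 ≤ ∣ p ∣ → Nonempty p
1≤∣p∣⇒Nonempty {n} p 1≤ with nonempty? p
... | yes ne = ne
... | no  ¬ne with () ← subst (1 ≤_) (trans (cong ∣_∣ (Empty-unique ¬ne)) (∣⊥∣≡0 n)) 1≤

Nonempty⇒1≤∣p∣ : (p : Subset n) → Nonempty p → 1 ≤ ∣ p ∣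
Nonempty⇒1≤∣p∣ p (x , x∈p) = subst (_≤ ∣ p ∣) (∣⁅x⁆∣≡1 x)
  (p⊆q⇒∣p∣≤∣q∣ (λ y∈ → subst (_∈ p) (sym (x∈⁅y⁆⇒x≡y x y∈)) x∈p))

Minimal : Pred (Subset n) ℓ → Pred (Subset n) ℓ
Minimal P C = P C × (∀ {D} → P D → D ⊆ C → D ≡ C)

minimal-below : {P : Pred (Subset n) ℓ} → Decidable P →
                ∀ {X} → P X → ∃ λ C → Minimal P C × C ⊆ X
minimal-below {P = P} P? {X} = go X (⊂-wellFounded X)
  where
  go : ∀ X → Acc _⊂_ X → P X → ∃ λ C → Minimal P C × C ⊆ X
  go X (acc rs) pX with anySubset? (λ D → P? D ×-dec (D ⊂? X))
  ... | yes (D , pD , D⊂X) =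
    let (C , minC , C⊆D) = go D (rs D⊂X) pD
    in C , minC , ⊆-trans C⊆D (p⊂q⇒p⊆q D⊂X)
  ... | no ∄D = X , (pX , λ pD D⊆X → ⊆-antisym D⊆X (X⊆ pD D⊆X)) , ⊆-refl
    where
    X⊆ : ∀ {D} → P D → D ⊆ X → X ⊆ D
    X⊆ {D} pD D⊆X {x} x∈X with x ∈? D
    ... | yes x∈D = x∈D
    ... | no  x∉D = contradiction (D , pD , (λ {y} → D⊆X {y}) , x , x∈X , x∉D) ∄D

------------------------------------------------------------------------
-- Matroids on the ground set Fin m, presented by their circuits

record Matroid (m : ℕ) : Set₁ where
  field
    Circuit     : Pred (Subset m) 0ℓ
    ⊥-¬circuit  : ¬ Circuit ⊥
    incomparable : ∀ {C D} → Circuit C → Circuit D → C ⊆ D → C ≡ D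
    elimination : ∀ {C D e} → Circuit C → Circuit D → C ≢ D → e ∈ C ∩ D →
                  ∃ λ Z → Circuit Z × Z ⊆ (C ∪ D) - e

  Independent : Pred (Subset m) 0ℓ
  Independent I = ∀ {C} → Circuit C → ¬ (C ⊆ I)

  Base : Pred (Subset m) 0ℓ
  Base B = Independent B × (∀ {I} → Independent I → B ⊆ I → I ≡ B)

  Cobase : Pred (Subset m) 0ℓ
  Cobase B = Base (∁ B)

  Trivial : Set
  Trivial = Base ⊤ ⊎ Cobase ⊤

------------------------------------------------------------------------
-- Graphs

-- The two components of `ends e` are the end vertices of e, in an order
-- that carries no meaning; e is a loop when they coincide.
record Graph : Set where
  field
    #V   : ℕ
    #E   : ℕ
    ends : Fin #E → Fin #V × Fin #V

  Incident : Fin #E → Fin #V → Set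
  Incident e v = v ≡ proj₁ (ends e) ⊎ v ≡ proj₂ (ends e)

  field
    no-isolated : ∀ v → ∃ λ e → Incident e v

module _ (G : Graph) where
  open Graph G

  -- Subgraphs may have isolated vertices; see CactiGraph.
  record Subgraph : Set where
    field
      V      : Subset #V
      E      : Subset #E
      closed : ∀ {e v} → e ∈ E → Incident e v → v ∈ V

module _ {G : Graph} where
  open Graph G
  open Subgraph

  infix 4 _≤ᴳ_

  _≤ᴳ_ : Subgraph G → Subgraph G → Set
  H ≤ᴳ K = V H ⊆ V K × E H ⊆ E K

  IsLoop : Fin #E → Set
  IsLoop e = proj₁ (ends e) ≡ proj₂ (ends e)

  Joins : Fin #E → Fin #V → Fin #V → Set
  Joins e u v = ends e ≡ (u , v) ⊎ ends e ≡ (v , u)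

  Δ : Subgraph G → ℤ
  Δ H = ∣ E H ∣ ⊖ ∣ V H ∣

  IsIsolated : Subgraph G → Fin #V → Set
  IsIsolated H v = v ∈ V H × ¬ (∃ λ e → e ∈ E H × Incident e v)

  IsLeaf : Subgraph G → Fin #V → Set
  IsLeaf H v = v ∈ V H × ∃ λ e →
    e ∈ E H × Incident e v × ¬ IsLoop e ×
    (∀ {f} → f ∈ E H → Incident f v → f ≡ e)

  Adjacent : Subgraph G → Fin #V → Fin #V → Set
  Adjacent H u v = ∃ λ e → e ∈ E H × Joins e u v

  Connected : Subgraph G → Set
  Connected H = Nonempty (V H) ×
    (∀ {u v} → u ∈ V H → v ∈ V H → Star (Adjacent H) u v)

  IsComponent : Subgraph G → Subgraph G → Set
  IsComponent H K = K ≤ᴳ H × Connected K ×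
    (∀ {L} → L ≤ᴳ H → Connected L → K ≤ᴳ L → L ≤ᴳ K)

  -- v₀ e₀ v₁ e₁ … vₗ eₗ v₀ with distinct vertices and distinct edges; l = 0
  -- is a single loop and l = 1 a pair of parallel edges.
  IsCycle : Subgraph G → Set
  IsCycle K = ∃ λ l →
    ∃ λ (v : Fin (suc l) → Fin #V) → ∃ λ (e : Fin (suc l) → Fin #E) →
      Injective _≡_ _≡_ v × Injective _≡_ _≡_ e ×
      (∀ i → Joins (e i) (v i) (v (suc (toℕ i) mod suc l))) ×
      (∀ x → x ∈ V K ⇔ (∃ λ i → v i ≡ x)) ×
      (∀ f → f ∈ E K ⇔ (∃ λ i → e i ≡ f))

  CactiGraph : Subgraph G → Set
  CactiGraph H =
    (∀ v → ¬ IsIsolated H v) ×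
    (∀ v → ¬ IsLeaf H v) ×
    (∀ K → IsComponent H K → ¬ IsCycle K)

module _ (G : Graph) where
  open Graph G
  open Subgraph

  incident? : ∀ e v → Dec (Incident e v)
  incident? e v = (v ≟ᶠ proj₁ (ends e)) ⊎-dec (v ≟ᶠ proj₂ (ends e))

  coveredBy? : ∀ X → Decidable (λ v → ∃ λ e → e ∈ X × Incident e v)
  coveredBy? X v = any? (λ e → (e ∈? X) ×-dec incident? e v)

  _⟨_⟩ : Subset #E → Subgraph G
  _⟨_⟩ X = record
    { V      = compr (coveredBy? X)
    ; E      = X
    ; closed = λ {e} e∈X inc → ∈-compr⁺ (coveredBy? X) (e , e∈X , inc)
    }

module _ (G : Graph) where
  open Graph G
  open Subgraph

  Tight : ℕ → Pred (Subset #E) 0ℓ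
  Tight k C = Nonempty C × ∣ C ∣ ≡ ∣ V (G ⟨ C ⟩) ∣ + k

  span : Subset #E → Subset #V
  span X = V (G ⟨ X ⟩)

  span⁺ : ∀ {X e v} → e ∈ X → Incident e v → v ∈ span X
  span⁺ {X} e∈X inc = ∈-compr⁺ (coveredBy? G X) (_ , e∈X , inc)

  span⁻ : ∀ {X v} → v ∈ span X → ∃ λ e → e ∈ X × Incident e v
  span⁻ {X} = ∈-compr⁻ (coveredBy? G X)

  span-mono : ∀ {X Y} → X ⊆ Y → span X ⊆ span Y
  span-mono X⊆Y v∈ = let (_ , e∈X , inc) = span⁻ v∈ in span⁺ (X⊆Y e∈X) inc

  span-∩ : ∀ X Y → span (X ∩ Y) ⊆ span X ∩ span Y
  span-∩ X Y v∈ = x∈p∩q⁺ (span-mono (p∩q⊆p X Y) v∈ , span-mono (p∩q⊆q X Y) v∈)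

  span-∪ : ∀ X Y → span (X ∪ Y) ⊆ span X ∪ span Y
  span-∪ X Y v∈ =
    let (_ , e∈ , inc) = span⁻ v∈
    in x∈p∪q⁺ (Sum.map (λ e∈X → span⁺ e∈X inc) (λ e∈Y → span⁺ e∈Y inc) (x∈p∪q⁻ X Y e∈))

  span-submodular : ∀ X Y →
    ∣ span (X ∪ Y) ∣ + ∣ span (X ∩ Y) ∣ ≤ ∣ span X ∣ + ∣ span Y ∣
  span-submodular X Y = ≤-trans
    (+-mono-≤ (p⊆q⇒∣p∣≤∣q∣ (span-∪ X Y)) (p⊆q⇒∣p∣≤∣q∣ (span-∩ X Y)))
    (≤-reflexive (∣p∪q∣+∣p∩q∣≡∣p∣+∣q∣ (span X) (span Y)))

  1≤∣span∣ : ∀ {X} → Nonempty X → 1 ≤ ∣ span X ∣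
  1≤∣span∣ {X} (e , e∈X) =
    Nonempty⇒1≤∣p∣ (span X) (proj₁ (ends e) , span⁺ e∈X (inj₁ refl))

  tight? : ∀ k → Decidable (Tight k)
  tight? k C = nonempty? C ×-dec (∣ C ∣ ≟ ∣ V (G ⟨ C ⟩) ∣ + k)

  -- Deleting an edge lowers |X| - |V(G⟨X⟩)| by at most one.
  tight-below : ∀ {k X} → Nonempty X → ∣ V (G ⟨ X ⟩) ∣ + k ≤ ∣ X ∣ →
                ∃ λ Y → Tight k Y × Y ⊆ X
  tight-below {k} {X} = go X (⊂-wellFounded X)
    where
    go : ∀ X → Acc _⊂_ X → Nonempty X → ∣ span X ∣ + k ≤ ∣ X ∣ →
         ∃ λ Y → Tight k Y × Y ⊆ X
    go X (acc rs) ne@(e , e∈X) large with ∣ X ∣ ≟ ∣ span X ∣ + k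
    ... | yes eq = X , (ne , eq) , ⊆-refl
    ... | no ≢ =
      let
        strict : suc (∣ span X ∣ + k) ≤ suc ∣ X - e ∣
        strict = ≤-trans (≤∧≢⇒< large (≢ ∘ sym)) (∣p∣≤1+∣p-x∣ X e)
        X-e⊂X = x∈p⇒p-x⊂p e∈X
        large′ = s≤s⁻¹ strict
        ne′ = 1≤∣p∣⇒Nonempty (X - e)
          (≤-trans (1≤∣span∣ ne) (≤-trans (m≤m+n _ k) large′))
        (Y , tY , Y⊆) = go (X - e) (rs X-e⊂X) ne′
          (≤-trans (+-monoˡ-≤ k (p⊆q⇒∣p∣≤∣q∣ (span-mono (p⊂q⇒p⊆q X-e⊂X)))) large′)
      in Y , tY , ⊆-trans Y⊆ (p⊂q⇒p⊆q X-e⊂X)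

  inter-sparse : ∀ {k C D e} → Minimal (Tight k) C → Minimal (Tight k) D → C ≢ D →
                 e ∈ C ∩ D → ∣ C ∩ D ∣ < ∣ span (C ∩ D) ∣ + k
  inter-sparse {k} {C} {D} (_ , minC) (_ , minD) C≢D e∈
    with ∣ span (C ∩ D) ∣ + k ≤? ∣ C ∩ D ∣
  ... | no  ≰ = ≰⇒> ≰
  ... | yes large =
    let (Y , tY , Y⊆) = tight-below (_ , e∈) large
    in contradiction
         (trans (sym (minC tY (⊆-trans Y⊆ (p∩q⊆p C D))))
                (minD tY (⊆-trans Y⊆ (p∩q⊆q C D))))
         C≢D

  union-dense : ∀ {k C D e} → Minimal (Tight k) C → Minimal (Tight k) D → C ≢ D →
                e ∈ C ∩ D → ∣ span (C ∪ D) ∣ + k < ∣ C ∪ D ∣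
  union-dense {k} {C} {D} mC@((_ , ∣C∣≡) , _) mD@((_ , ∣D∣≡) , _) C≢D e∈ =
    +-cancelʳ-< (∣ span (C ∩ D) ∣ + k) _ _ (begin-strict
      (u + k) + (i + k)                  ≡⟨ shuffle u k i k ⟩
      (u + i) + (k + k)                  ≤⟨ +-monoˡ-≤ (k + k) (span-submodular C D) ⟩
      (∣ span C ∣ + ∣ span D ∣) + (k + k) ≡⟨ shuffle (∣ span C ∣) (∣ span D ∣) k k ⟩
      (∣ span C ∣ + k) + (∣ span D ∣ + k) ≡⟨ cong₂ _+_ ∣C∣≡ ∣D∣≡ ⟨
      ∣ C ∣ + ∣ D ∣                       ≡⟨ ∣p∪q∣+∣p∩q∣≡∣p∣+∣q∣ C D ⟨
      ∣ C ∪ D ∣ + ∣ C ∩ D ∣               <⟨ +-monoʳ-< ∣ C ∪ D ∣ (inter-sparse mC mD C≢D e∈) ⟩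
      ∣ C ∪ D ∣ + (i + k)                ∎)
    where
    open ≤-Reasoning
    u = ∣ span (C ∪ D) ∣
    i = ∣ span (C ∩ D) ∣
    shuffle : ∀ a b c d → (a + b) + (c + d) ≡ (a + c) + (b + d)
    shuffle = solve-∀

  M : ℕ → Matroid #E
  M k = record
    { Circuit      = Minimal (Tight k)
    ; ⊥-¬circuit   = λ { (((_ , e∈⊥) , _) , _) → ∉⊥ e∈⊥ }
    ; incomparable = λ (tC , _) (_ , minD) C⊆D → minD tC C⊆D
    ; elimination  = elim
    }
    where
    elim : ∀ {C D e} → Minimal (Tight k) C → Minimal (Tight k) D → C ≢ D → e ∈ C ∩ D →
           ∃ λ Z → Minimal (Tight k) Z × Z ⊆ (C ∪ D) - e
    elim {C} {D} {e} mC mD C≢D e∈ =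
      let
        U = C ∪ D
        e∈U = x∈p∪q⁺ {p = C} {q = D} (inj₁ (proj₁ (x∈p∩q⁻ C D e∈)))
        large = s≤s⁻¹ (≤-trans (union-dense mC mD C≢D e∈) (∣p∣≤1+∣p-x∣ U e))
        ne = 1≤∣p∣⇒Nonempty (U - e)
          (≤-trans (1≤∣span∣ (e , e∈U)) (≤-trans (m≤m+n _ k) large))
        (Y , tY , Y⊆) = tight-below ne
          (≤-trans (+-monoˡ-≤ k (p⊆q⇒∣p∣≤∣q∣ (span-mono (p⊂q⇒p⊆q (x∈p⇒p-x⊂p e∈U))))) large)
        (Z , mZ , Z⊆Y) = minimal-below (tight? k) tY
      in Z , mZ , ⊆-trans Z⊆Y Y⊆

{-# OPTIONS --safe #-}

-- For k ≥ 1 no single edge is a circuit of M_k(G), so M_k(G) is trivial exactly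
-- when it has no circuit.  The edge set of a cacti-graph F with ΔF = k is
-- tight, hence contains a circuit.  Conversely, if C is a circuit then G⟨C⟩ is
-- a cacti-graph: removing a leaf edge (1 edge, ≥ 1 vertex) or a cycle component
-- (equally many edges and vertices) would leave a set X with
-- |X| ≥ |V(G⟨X⟩)| + k, which contains a tight set properly inside C.
module Submission where

open import Defs
open import Data.Fin.Base using (Fin; zero; suc)
open import Data.Fin.Properties using (suc-injective; 0≢1+n)
open import Data.Fin.Subset
open import Data.Fin.Subset.Properties
open import Data.Integer.Base using (+_; _⊖_)
open import Data.Integer.Properties using ([1+m]⊖[1+n]≡m⊖n; +-injective)
open import Data.Nat.Base using (ℕ; zero; suc; _+_; _≤_; s≤s)
open import Data.Nat.Properties
  using (+-assoc; +-comm; +-identityʳ; +-monoˡ-≤; +-monoʳ-≤; +-mono-≤; +-cancelʳ-≤;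
         m≤m+n; m≤n+m; ≤-trans; ≤-reflexive; ≤-antisym; module ≤-Reasoning)
open import Data.Product.Base using (∃; _×_; _,_; proj₁; proj₂)
open import Data.Sum.Base using (_⊎_; inj₁; inj₂; [_,_]′)
open import Function.Base using (_∘_)
open import Function.Bundles using (_⇔_; mk⇔; Equivalence)
open import Function.Definitions using (Injective)
open import Relation.Binary.Construct.Closure.ReflexiveTransitive
  using (Star; ε; _◅_; _◅◅_; reverse)
import Relation.Binary.Construct.Closure.ReflexiveTransitive as Star
open import Relation.Binary.PropositionalEquality
  using (_≡_; refl; sym; trans; cong; subst)
open import Relation.Nullary using (¬_; yes; no; contradiction)

private
  variable
    m n : ℕ

-- Integer differences and cardinalities of finite sets

m⊖n≡+k⇒m≡n+k : ∀ m n {k} → m ⊖ n ≡ + k → m ≡ n + k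
m⊖n≡+k⇒m≡n+k m       zero    eq = +-injective eq
m⊖n≡+k⇒m≡n+k zero    (suc n) ()
m⊖n≡+k⇒m≡n+k (suc m) (suc n) eq =
  cong suc (m⊖n≡+k⇒m≡n+k m n (trans (sym ([1+m]⊖[1+n]≡m⊖n m n)) eq))

[n+k]⊖n≡+k : ∀ n k → (n + k) ⊖ n ≡ + k
[n+k]⊖n≡+k zero    k = refl
[n+k]⊖n≡+k (suc n) k = trans ([1+m]⊖[1+n]≡m⊖n (n + k) n) ([n+k]⊖n≡+k n k)

disjoint⇒∣p∣+∣q∣≤∣r∣ : {p q r : Subset n} → p ⊆ r → q ⊆ r →
                       (∀ {x} → x ∈ p → x ∉ q) → ∣ p ∣ + ∣ q ∣ ≤ ∣ r ∣
disjoint⇒∣p∣+∣q∣≤∣r∣ {n} {p} {q} {r} p⊆r q⊆r disj = begin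
  ∣ p ∣ + ∣ q ∣             ≡⟨ ∣p∪q∣+∣p∩q∣≡∣p∣+∣q∣ p q ⟨
  ∣ p ∪ q ∣ + ∣ p ∩ q ∣     ≡⟨ cong (λ s → ∣ p ∪ q ∣ + s) ∣p∩q∣≡0 ⟩
  ∣ p ∪ q ∣ + 0             ≡⟨ +-identityʳ _ ⟩
  ∣ p ∪ q ∣                 ≤⟨ p⊆q⇒∣p∣≤∣q∣ ([ p⊆r , q⊆r ]′ ∘ x∈p∪q⁻ p q) ⟩
  ∣ r ∣                     ∎
  where
  open ≤-Reasoning
  ∣p∩q∣≡0 : ∣ p ∩ q ∣ ≡ 0
  ∣p∩q∣≡0 = trans
    (cong ∣_∣ (Empty-unique λ (_ , x∈) → let (x∈p , x∈q) = x∈p∩q⁻ p q x∈ in disj x∈p x∈q))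
    (∣⊥∣≡0 n)

∣p∣≤∣p∩∁q∣+∣q∣ : (p q : Subset n) → ∣ p ∣ ≤ ∣ p ∩ ∁ q ∣ + ∣ q ∣
∣p∣≤∣p∩∁q∣+∣q∣ p q = begin
  ∣ p ∣                                            ≤⟨ p⊆q⇒∣p∣≤∣q∣ p⊆ ⟩
  ∣ (p ∩ ∁ q) ∪ q ∣                                ≤⟨ m≤m+n _ _ ⟩
  ∣ (p ∩ ∁ q) ∪ q ∣ + ∣ (p ∩ ∁ q) ∩ q ∣            ≡⟨ ∣p∪q∣+∣p∩q∣≡∣p∣+∣q∣ (p ∩ ∁ q) q ⟩
  ∣ p ∩ ∁ q ∣ + ∣ q ∣                              ∎
  where
  open ≤-Reasoning
  p⊆ : p ⊆ (p ∩ ∁ q) ∪ q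
  p⊆ {x} x∈p with x ∈? q
  ... | yes x∈q = x∈p∪q⁺ (inj₂ x∈q)
  ... | no  x∉q = x∈p∪q⁺ (inj₁ (x∈p∩q⁺ (x∈p , x∉p⇒x∈∁p x∉q)))

-- Induction on `m`: by injectivity, taking `f zero` out of `p` leaves exactly the image of
-- `f ∘ suc`.
∣image∣ : (p : Subset n) (f : Fin m → Fin n) → Injective _≡_ _≡_ f →
          (∀ x → x ∈ p ⇔ (∃ λ i → f i ≡ x)) → ∣ p ∣ ≡ m
∣image∣ {n} {zero} p f inj im =
  trans (cong ∣_∣ (Empty-unique λ (x , x∈p) → ¬image (Equivalence.to (im x) x∈p))) (∣⊥∣≡0 n)
  where
  ¬image : ∀ {x} → ¬ (∃ λ i → f i ≡ x)
  ¬image (() , _)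
∣image∣ {n} {suc m} p f inj im = trans ∣p∣≡∣p∩∁⁅f0⁆∣+1
  (trans (cong (_+ 1) (∣image∣ (p ∩ ∁ ⁅ f zero ⁆) (f ∘ suc) (suc-injective ∘ inj) im′))
         (+-comm m 1))
  where
  to : ∀ {x} → x ∈ p ∩ ∁ ⁅ f zero ⁆ → ∃ λ i → f (suc i) ≡ x
  to {x} x∈ with x∈p∩q⁻ p _ x∈
  ... | x∈p , x∉f0 with Equivalence.to (im x) x∈p
  ...   | zero  , refl = contradiction (x∈⁅x⁆ (f zero)) (x∈∁p⇒x∉p x∉f0)
  ...   | suc i , eq   = i , eq

  from : ∀ {x} → (∃ λ i → f (suc i) ≡ x) → x ∈ p ∩ ∁ ⁅ f zero ⁆
  from (i , refl) = x∈p∩q⁺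
    ( Equivalence.from (im _) (suc i , refl)
    , x∉p⇒x∈∁p λ fi∈ → 0≢1+n (sym (inj (x∈⁅y⁆⇒x≡y _ fi∈))) )

  im′ : ∀ x → x ∈ p ∩ ∁ ⁅ f zero ⁆ ⇔ (∃ λ i → f (suc i) ≡ x)
  im′ x = mk⇔ to from

  f0⊆p : ⁅ f zero ⁆ ⊆ p
  f0⊆p x∈ = Equivalence.from (im _) (zero , sym (x∈⁅y⁆⇒x≡y _ x∈))

  ∣p∣≡∣p∩∁⁅f0⁆∣+1 : ∣ p ∣ ≡ ∣ p ∩ ∁ ⁅ f zero ⁆ ∣ + 1
  ∣p∣≡∣p∩∁⁅f0⁆∣+1 = trans
    (≤-antisym (∣p∣≤∣p∩∁q∣+∣q∣ p ⁅ f zero ⁆)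
      (disjoint⇒∣p∣+∣q∣≤∣r∣ (p∩q⊆p p _) f0⊆p (x∈∁p⇒x∉p ∘ proj₂ ∘ x∈p∩q⁻ p _)))
    (cong (λ s → ∣ p ∩ ∁ ⁅ f zero ⁆ ∣ + s) (∣⁅x⁆∣≡1 (f zero)))

-- Cycles and components of subgraphs

module _ {G : Graph} where
  open Graph G
  open Subgraph

  ∣cycle∣ : ∀ {K} → IsCycle {G} K → Nonempty (E K) × ∣ E K ∣ ≡ ∣ V K ∣
  ∣cycle∣ {K} (l , v , e , v-inj , e-inj , _ , imV , imE) =
    (e zero , Equivalence.from (imE _) (zero , refl)) ,
    trans (∣image∣ (E K) e e-inj imE) (sym (∣image∣ (V K) v v-inj imV))

  incident⇒≡⊎joins : ∀ {e u v} → Incident e u → Incident e v → u ≡ v ⊎ Joins {G} e u v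
  incident⇒≡⊎joins (inj₁ refl) (inj₁ refl) = inj₁ refl
  incident⇒≡⊎joins (inj₁ refl) (inj₂ refl) = inj₂ (inj₁ refl)
  incident⇒≡⊎joins (inj₂ refl) (inj₁ refl) = inj₂ (inj₂ refl)
  incident⇒≡⊎joins (inj₂ refl) (inj₂ refl) = inj₁ refl

  adjacent-sym : ∀ {H u v} → Adjacent {G} H u v → Adjacent H v u
  adjacent-sym (e , e∈ , inj₁ j) = e , e∈ , inj₂ j
  adjacent-sym (e , e∈ , inj₂ j) = e , e∈ , inj₁ j

  -- Adding `e` and its ends to `K` gives a subgraph `L` of `H` that stays connected, because `e`
  -- meets `K` at `v`. Maximality of the component then forces `L` back inside `K`.
  component-closed : ∀ {H K : Subgraph G} {e v} → IsComponent H K →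
                     e ∈ E H → Incident e v → v ∈ V K → e ∈ E K
  component-closed {H} {K} {e} {v} ((VK⊆VH , EK⊆EH) , (_ , conn) , maximal) e∈H inc v∈K =
    proj₂ (maximal {L} L≤H ((v , p⊆p∪q _ v∈K) , L-conn) (p⊆p∪q _ , p⊆p∪q _))
      (q⊆p∪q (E K) ⁅ e ⁆ (x∈⁅x⁆ e))
    where
    L : Subgraph G
    L = record
      { V      = V K ∪ span G ⁅ e ⁆
      ; E      = E K ∪ ⁅ e ⁆
      ; closed = λ f∈ incf → x∈p∪q⁺
          ([ (λ f∈K → inj₁ (closed K f∈K incf)) , (λ f∈e → inj₂ (span⁺ G f∈e incf)) ]′
            (x∈p∪q⁻ (E K) ⁅ e ⁆ f∈))
      }

    span⊆VH : span G ⁅ e ⁆ ⊆ V H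
    span⊆VH u∈ =
      let (f , f∈ , incf) = span⁻ G u∈
      in closed H (subst (_∈ E H) (sym (x∈⁅y⁆⇒x≡y e f∈)) e∈H) incf

    L≤H : L ≤ᴳ H
    L≤H = [ VK⊆VH , span⊆VH ]′ ∘ x∈p∪q⁻ (V K) _
        , [ EK⊆EH , (λ f∈ → subst (_∈ E H) (sym (x∈⁅y⁆⇒x≡y e f∈)) e∈H) ]′ ∘ x∈p∪q⁻ (E K) _

    -- The vertex `v` serves as a hub: a vertex of `K` reaches it inside `K`, and an end of `e`
    -- either is `v` or is joined to it by `e`.
    to-v : ∀ {u} → u ∈ V L → Star (Adjacent L) u v
    to-v u∈ with x∈p∪q⁻ (V K) _ u∈
    ... | inj₁ u∈K = Star.map (λ (f , f∈ , j) → f , p⊆p∪q _ f∈ , j) (conn u∈K v∈K)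
    ... | inj₂ u∈e with span⁻ G u∈e
    ...   | f , f∈ , incf with x∈⁅y⁆⇒x≡y e f∈
    ...     | refl with incident⇒≡⊎joins incf inc
    ...       | inj₁ refl = ε
    ...       | inj₂ j    = (e , q⊆p∪q (E K) ⁅ e ⁆ f∈ , j) ◅ ε

    L-conn : ∀ {u w} → u ∈ V L → w ∈ V L → Star (Adjacent L) u w
    L-conn u∈ w∈ = to-v u∈ ◅◅ reverse (adjacent-sym {L}) (to-v w∈)

-- Circuits of `M G k` for positive `k`

module _ (G : Graph) {k : ℕ} (1≤k : 1 ≤ k) where
  open Graph G
  open Subgraph
  open Matroid (M G k)

  -- Covers both deletions, of a leaf with its edge and of a cycle component. Without `D`, the
  -- circuit loses every vertex of `W`; if `D` had no more edges than `W` has vertices, the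
  -- remainder would still contain a tight set. That set lies in `C` and misses the edge `d`,
  -- against minimality.
  circuit-irremovable : ∀ {C} → Circuit C → (D : Subset #E) → Nonempty (D ∩ C) →
    (W : Subset #V) → W ⊆ span G C →
    (∀ {e v} → e ∈ C → Incident e v → v ∈ W → e ∈ D) → ¬ (∣ D ∣ ≤ ∣ W ∣)
  circuit-irremovable {C} ((_ , ∣C∣≡) , minC) D (d , d∈) W W⊆ W-only ∣D∣≤∣W∣ =
    let (Y , tY , Y⊆X) = tight-below G nonempty large
        (d∈D , d∈C) = x∈p∩q⁻ D C d∈
        Y≡C = minC tY (p∩q⊆p C _ ∘ Y⊆X)
        d∈X = Y⊆X (subst (d ∈_) (sym Y≡C) d∈C)
    in X-avoids-D d∈X d∈D
    where
    open ≤-Reasoning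
    X : Subset #E
    X = C ∩ ∁ D

    X-avoids-D : ∀ {e} → e ∈ X → e ∉ D
    X-avoids-D = x∈∁p⇒x∉p ∘ proj₂ ∘ x∈p∩q⁻ C _

    spanX-avoids-W : ∀ {v} → v ∈ span G X → v ∉ W
    spanX-avoids-W v∈ v∈W =
      let (e , e∈X , inc) = span⁻ G v∈
      in X-avoids-D e∈X (W-only (p∩q⊆p C _ e∈X) inc v∈W)

    -- Two estimates meet here: `span G X` and `W` are disjoint inside `span G C`, and passing from
    -- `C` to `X` costs at most `∣ D ∣` edges.
    large : ∣ span G X ∣ + k ≤ ∣ X ∣
    large = +-cancelʳ-≤ ∣ W ∣ _ _ (begin
      (∣ span G X ∣ + k) + ∣ W ∣   ≡⟨ +-assoc (∣ span G X ∣) k _ ⟩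
      ∣ span G X ∣ + (k + ∣ W ∣)   ≡⟨ cong (λ s → ∣ span G X ∣ + s) (+-comm k _) ⟩
      ∣ span G X ∣ + (∣ W ∣ + k)   ≡⟨ +-assoc (∣ span G X ∣) _ k ⟨
      (∣ span G X ∣ + ∣ W ∣) + k   ≤⟨ +-monoˡ-≤ k (disjoint⇒∣p∣+∣q∣≤∣r∣
                                        (span-mono G (p∩q⊆p C _)) W⊆ spanX-avoids-W) ⟩
      ∣ span G C ∣ + k             ≡⟨ ∣C∣≡ ⟨
      ∣ C ∣                        ≤⟨ ∣p∣≤∣p∩∁q∣+∣q∣ C D ⟩
      ∣ X ∣ + ∣ D ∣                ≤⟨ +-monoʳ-≤ (∣ X ∣) ∣D∣≤∣W∣ ⟩
      ∣ X ∣ + ∣ W ∣                ∎)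

    -- By `large`, `X` has at least `k` edges, so `1≤k` rules out that the deletion leaves nothing.
    nonempty : Nonempty X
    nonempty = 1≤∣p∣⇒Nonempty X (≤-trans 1≤k (≤-trans (m≤n+m k _) large))

  circuit⇒cacti : ∀ {C} → Circuit C → CactiGraph (G ⟨ C ⟩)
  circuit⇒cacti {C} circ = no-isolated-vertex , no-leaf , no-cycle
    where
    no-isolated-vertex : ∀ v → ¬ IsIsolated (G ⟨ C ⟩) v
    no-isolated-vertex v (v∈ , isolated) = isolated (span⁻ G v∈)

    no-leaf : ∀ v → ¬ IsLeaf (G ⟨ C ⟩) v
    no-leaf v (v∈ , e , e∈C , _ , _ , only-e) =
      circuit-irremovable circ ⁅ e ⁆ (e , x∈p∩q⁺ (x∈⁅x⁆ e , e∈C)) ⁅ v ⁆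
        (λ u∈ → subst (_∈ span G C) (sym (x∈⁅y⁆⇒x≡y v u∈)) v∈)
        (λ {f} f∈C inc u∈ → subst (_∈ ⁅ e ⁆)
          (sym (only-e f∈C (subst (Incident f) (x∈⁅y⁆⇒x≡y v u∈) inc))) (x∈⁅x⁆ e))
        (≤-reflexive (trans (∣⁅x⁆∣≡1 e) (sym (∣⁅x⁆∣≡1 v))))

    no-cycle : ∀ K → IsComponent (G ⟨ C ⟩) K → ¬ IsCycle K
    no-cycle K comp@((VK⊆ , EK⊆) , _) cycle =
      -- As a component, `K` contains every edge of `C` that meets it, so deleting `E K` uncovers
      -- all of `V K`.
      let ((e , e∈K) , ∣E∣≡∣V∣) = ∣cycle∣ {K = K} cycle
      in circuit-irremovable circ (E K) (e , x∈p∩q⁺ (e∈K , EK⊆ e∈K)) (V K) VK⊆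
           (component-closed {H = G ⟨ C ⟩} {K} comp) (≤-reflexive ∣E∣≡∣V∣)

  -- Without isolated vertices, `V F` is exactly the set of vertices covered by `E F`, so `Δ F`
  -- measures the same excess as tightness. A positive excess forces an edge.
  cacti⇒tight : (F : Subgraph G) → CactiGraph F → Δ F ≡ + k → Tight G k (E F)
  cacti⇒tight F (no-iso , _) ΔF≡k =
    1≤∣p∣⇒Nonempty (E F) (≤-trans 1≤k (≤-trans (m≤n+m k _) (≤-reflexive (sym ∣E∣≡)))) ,
    subst (λ W → ∣ E F ∣ ≡ ∣ W ∣ + k) VF≡span ∣E∣≡
    where
    ∣E∣≡ : ∣ E F ∣ ≡ ∣ V F ∣ + k
    ∣E∣≡ = m⊖n≡+k⇒m≡n+k (∣ E F ∣) (∣ V F ∣) ΔF≡k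

    VF⊆span : V F ⊆ span G (E F)
    VF⊆span {v} v∈ with coveredBy? G (E F) v
    ... | yes (e , e∈ , inc) = span⁺ G e∈ inc
    ... | no  ¬covered       = contradiction (v∈ , ¬covered) (no-iso v)

    VF≡span : V F ≡ span G (E F)
    VF≡span = ⊆-antisym VF⊆span
      (λ v∈ → let (_ , e∈ , inc) = span⁻ G v∈ in closed F e∈ inc)

  -- A tight set covers at least one vertex, so it has at least `1 + k`, hence two, edges.
  singleton-independent : ∀ e → Independent ⁅ e ⁆
  singleton-independent e {C} ((ne , ∣C∣≡) , _) C⊆ = contradiction 2≤1 λ { (s≤s ()) }
    where
    open ≤-Reasoning
    2≤1 : 2 ≤ 1
    2≤1 = begin
      1 + 1               ≤⟨ +-mono-≤ (1≤∣span∣ G ne) 1≤k ⟩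
      ∣ span G C ∣ + k    ≡⟨ ∣C∣≡ ⟨
      ∣ C ∣               ≤⟨ p⊆q⇒∣p∣≤∣q∣ C⊆ ⟩
      ∣ ⁅ e ⁆ ∣           ≡⟨ ∣⁅x⁆∣≡1 e ⟩
      1                   ∎

  trivial⇒¬circuit : Trivial → ∀ {C} → ¬ Circuit C
  trivial⇒¬circuit (inj₁ (indep , _)) circ = indep circ (⊆-max _)
  -- Here the empty set `∁ ⊤` is a base, yet any edge of the supposed circuit gives an independent
  -- singleton strictly above it.
  trivial⇒¬circuit (inj₂ (_ , maximal)) (((e , _) , _) , _) =
    x∈∁p⇒x∉p (subst (e ∈_) ⁅e⁆≡∁⊤ (x∈⁅x⁆ e)) ∈⊤
    where
    ⁅e⁆≡∁⊤ : ⁅ e ⁆ ≡ ∁ ⊤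
    ⁅e⁆≡∁⊤ = maximal (singleton-independent e)
      (λ x∈ → contradiction ∈⊤ (x∈∁p⇒x∉p x∈))

  ¬circuit⇒trivial : (∀ {C} → ¬ Circuit C) → Trivial
  ¬circuit⇒trivial ¬circ = inj₁ ((λ circ _ → ¬circ circ) , λ _ ⊤⊆I → ⊆-antisym (⊆-max _) ⊤⊆I)

mainTheorem11 : (G : Graph) (k : ℕ) → 1 ≤ k →
    Matroid.Trivial (M G k) ⇔
    (¬ (∃ λ (F : Subgraph G) → CactiGraph F × Δ F ≡ + k))
mainTheorem11 G k 1≤k = mk⇔
  (λ triv (F , cacti , ΔF≡k) →
    -- `E F` is tight but perhaps not minimal, so a circuit is taken inside it.
    let (_ , circ , _) = minimal-below (tight? G k) (cacti⇒tight G 1≤k F cacti ΔF≡k)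
    in trivial⇒¬circuit G 1≤k triv circ)
  (λ ¬F → ¬circuit⇒trivial G 1≤k λ {C} circ@((_ , ∣C∣≡) , _) →
    ¬F (G ⟨ C ⟩ , circuit⇒cacti G 1≤k circ ,
        trans (cong (_⊖ ∣ span G C ∣) ∣C∣≡) ([n+k]⊖n≡+k (∣ span G C ∣) k)))
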